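{- For every integer $\ell\ge 1$, setting $n=2^{2\ell-1}+1$, one has $$R(B_{n-2},B_n)=4n-3.$$
   Context: For a positive integer $n$, the book graph $B_n=K_2+\overline{K}_n$ is the graph consisting of $n$ triangles sharing a common edge. The Ramsey number $R(B_m,B_n)$ is the smallest integer $N$ such that every red/blue coloring of the edges of $K_N$ contains a red copy of $B_m$ or a blue copy of $B_n$ (copies are as not necessarily induced subgraphs). -}

module Defs where

open import Data.Empty using (⊥)
open import Data.Fin using (Fin)
open import Data.Nat using (ℕ; _≤_)
open import Data.Product using (Σ; _×_; _,_)
open import Data.Sum using (_⊎_; inj₁; inj₂)
open import Data.Unit using (⊤; tt)
open import Function.Definitions using (Injective)
open import Level using (0ℓ)
open import Relation.Binary.Core using (Rel)
open import Relation.Binary.Definitions using (Symmetric; Irreflexive)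
open import Relation.Binary.PropositionalEquality using (_≡_; _≢_; refl; trans; ≢-sym)

record Graph : Set₁ where
  field
    Vertex     : Set
    Adj        : Rel Vertex 0ℓ
    adj-sym    : Symmetric Adj
    adj-irrefl : Irreflexive _≡_ Adj

open Graph public

complete : ℕ → Graph
complete n = record
  { Vertex     = Fin n
  ; Adj        = _≢_
  ; adj-sym    = ≢-sym
  ; adj-irrefl = λ x≡y x≢y → x≢y x≡y
  }

edgeless : ℕ → Graph
edgeless n = record
  { Vertex     = Fin n
  ; Adj        = λ _ _ → ⊥
  ; adj-sym    = λ ()
  ; adj-irrefl = λ _ ()
  }

JoinAdj : (G H : Graph) → Rel (Vertex G ⊎ Vertex H) 0ℓ
JoinAdj G H (inj₁ u) (inj₁ v) = Adj G u v
JoinAdj G H (inj₁ _) (inj₂ _) = ⊤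
JoinAdj G H (inj₂ _) (inj₁ _) = ⊤
JoinAdj G H (inj₂ u) (inj₂ v) = Adj H u v

joinAdj-sym : (G H : Graph) → Symmetric (JoinAdj G H)
joinAdj-sym G H {inj₁ _} {inj₁ _} a = adj-sym G a
joinAdj-sym G H {inj₁ _} {inj₂ _} _ = tt
joinAdj-sym G H {inj₂ _} {inj₁ _} _ = tt
joinAdj-sym G H {inj₂ _} {inj₂ _} a = adj-sym H a

joinAdj-irrefl : (G H : Graph) → Irreflexive _≡_ (JoinAdj G H)
joinAdj-irrefl G H {inj₁ _} refl a = adj-irrefl G refl a
joinAdj-irrefl G H {inj₂ _} refl a = adj-irrefl H refl a

-- The sum G + H of graph theory: the disjoint union together with all edges
-- between the two parts.
join : Graph → Graph → Graph
join G H = record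
  { Vertex     = Vertex G ⊎ Vertex H
  ; Adj        = JoinAdj G H
  ; adj-sym    = λ {x} {y} → joinAdj-sym G H {x} {y}
  ; adj-irrefl = λ {x} {y} → joinAdj-irrefl G H {x} {y}
  }

book : ℕ → Graph
book n = join (complete 2) (edgeless n)

-- G contains a copy of H as a not necessarily induced subgraph.
Contains : Graph → Graph → Set
Contains G H =
  Σ (Vertex H → Vertex G) λ f →
    Injective _≡_ _≡_ f × (∀ u v → Adj H u v → Adj G (f u) (f v))

data Colour : Set where
  red blue : Colour

-- An edge colouring of the complete graph on N vertices.  The values on the
-- diagonal carry no meaning: `colourGraph` discards them.
record Colouring (N : ℕ) : Set where
  field
    colour     : Fin N → Fin N → Colour
    colour-sym : ∀ u v → colour u v ≡ colour v u

open Colouring public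

colourGraph : ∀ {N} → Colouring N → Colour → Graph
colourGraph {N} χ c = record
  { Vertex     = Fin N
  ; Adj        = λ u v → u ≢ v × colour χ u v ≡ c
  ; adj-sym    = λ {u} {v} (u≢v , p) → ≢-sym u≢v , trans (colour-sym χ v u) p
  ; adj-irrefl = λ u≡v (u≢v , _) → u≢v u≡v
  }

Arrows : ℕ → Graph → Graph → Set
Arrows N G H =
  (χ : Colouring N) →
    Contains (colourGraph χ red) G ⊎ Contains (colourGraph χ blue) H

-- R(G , H) = N, i.e. N is the least number with the arrowing property.
IsRamseyNumber : Graph → Graph → ℕ → Set
IsRamseyNumber G H N =
  Arrows N G H × (∀ M → Arrows M G H → N ≤ M)

{-# OPTIONS --safe #-}
module Submission where

-- Put k = n - 1 = 2 · 4^(ℓ-1), so that the claim reads R(B_{k-1}, B_{k+1}) = 4k + 1.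
--
-- Lower bound: let H be a symmetric Hadamard matrix of order 4^ℓ with constant
-- diagonal 1, and K = [[1,-1],[-1,1]] ⊗ H, of order 4k.  The rows of K sum to 0 and
-- distinct rows have inner product 0 or -4k, so for either sign s two rows share
-- the entry s in at most k columns.  Colour uv red iff K_uv = 1.  A blue book uses
-- only its pages as such columns; a red one uses its two spine vertices as well.
--
-- Upper bound (Rousseau–Sheehan): if every red edge of a colouring on 4k + 1 vertices
-- lies in at most k - 2 red triangles and every blue edge in at most k blue ones,
-- then counting monochromatic triangles gives Σ_u x_u (3 x_u + 2) ≤ 0, where
-- x_u + 2k is the red degree of u.  As x (3x + 2) ≥ 0 for integers, all the bounds
-- are equalities, and the red adjacency matrix satisfies A² = (k-1) I - 3A + (k+1) J
-- and AJ = 2k J.  These relations determine tr A⁵, the number of closed walks of length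
-- 5; it is divisible by 5, because rotation permutes these walks without fixed point.
-- Since k² = -1 modulo 5, the computed value is not.

open import Defs
open import Data.Bool using (Bool; true; false; if_then_else_; _∧_)
open import Data.Empty using (⊥; ⊥-elim)
open import Data.Fin using (Fin; zero; suc; _≟_; inject≤; combine; quotient; remainder; opposite; _↑ˡ_; _↑ʳ_; splitAt)
  renaming (join to joinᶠ)
open import Data.Fin.Properties
  using (any?; all?; inject≤-injective; injective⇒≤; join-splitAt; combine-remQuot; remQuot-combine)
open import Data.Integer using (ℤ; +_; -[1+_]; -_; _+_; _*_; _-_; _≤_; 0ℤ; 1ℤ; -1ℤ; +≤+; drop‿+≤+)
open import Data.Integer.Divisibility.Signed using (divides; ∣⇒∣ᵤ)
open import Data.Integer.Properties as ℤ hiding (_≟_)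
open import Data.Integer.Tactic.RingSolver using (solve-∀)
open import Data.List using (List; length; filter; tabulate; allFin; lookup)
open import Data.List.Membership.Propositional using (_∈_)
open import Data.List.Membership.Propositional.Properties using (∈-filter⁺; ∈-filter⁻; ∈-allFin; ∈-lookup)
import Data.List.Relation.Unary.All as All
open import Data.List.Relation.Unary.AllPairs using (_∷_)
import Data.List.Relation.Unary.Any as Any
open import Data.List.Relation.Unary.Any.Properties using (lookup-index)
open import Data.List.Relation.Unary.Unique.Propositional using (Unique)
open import Data.List.Relation.Unary.Unique.Propositional.Properties using (allFin⁺; filter⁺)
open import Data.Nat as ℕ using (ℕ; zero; suc; z≤n)
open import Data.Nat.Divisibility using (_∣?_)
import Data.Nat.Properties as ℕ
import Data.Nat.Tactic.RingSolver as ℕ-solver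
open import Data.Product using (∃; _×_; _,_; proj₁; proj₂)
open import Data.Sum using (_⊎_; inj₁; inj₂; [_,_]′)
open import Data.Unit using (tt)
open import Data.Vec.Functional using (Vector; head; tail)
open import Function using (_∘_; id; Injective)
open import Level using (0ℓ)
open import Relation.Binary.PropositionalEquality
open import Relation.Nullary using (Dec; does; yes; no; contradiction; ¬_; ¬?; _×-dec_; _⊎-dec_)
open import Relation.Nullary.Decidable using (from-no; from-yes; dec-true; dec-false)
open import Relation.Unary using (Pred; Decidable)
open import Algebra.Properties.Semiring.Sum +-*-semiring
  using (sum; sum-cong-≗; ∑-comm; ∑-distrib-+; *-distribˡ-sum; *-distribʳ-sum)

open ≡-Reasoning

-- Finite sums of integers.

⟦_⟧ : Bool → ℤ
⟦ true ⟧  = 1ℤ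
⟦ false ⟧ = 0ℤ

sum-const : ∀ n c → sum {n} (λ _ → c) ≡ + n * c
sum-const zero    c = sym (*-zeroˡ c)
sum-const (suc n) c = begin
  c + sum {n} (λ _ → c) ≡⟨ cong (λ s → c + s) (sum-const n c) ⟩
  c + + n * c           ≡⟨ suc-* (+ n) c ⟨
  (+ suc n) * c         ∎

sum-neg : ∀ {n} (f : Vector ℤ n) → sum (λ i → - f i) ≡ - sum f
sum-neg f = begin
  sum (λ i → - f i)     ≡⟨ sum-cong-≗ (λ i → sym (-1*i≡-i (f i))) ⟩
  sum (λ i → -1ℤ * f i) ≡⟨ *-distribˡ-sum -1ℤ f ⟨
  -1ℤ * sum f           ≡⟨ -1*i≡-i (sum f) ⟩
  - sum f               ∎

sum-sub : ∀ {n} (f g : Vector ℤ n) → sum (λ i → f i - g i) ≡ sum f - sum g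
sum-sub f g = trans (∑-distrib-+ f (λ i → - g i)) (cong (λ s → sum f + s) (sum-neg g))

sum-nonNeg : ∀ {n} {f : Vector ℤ n} → (∀ i → 0ℤ ≤ f i) → 0ℤ ≤ sum f
sum-nonNeg {zero}  0≤f = ≤-refl
sum-nonNeg {suc n} 0≤f = +-mono-≤ (0≤f zero) (sum-nonNeg (0≤f ∘ suc))

+-nonNeg-≡0ˡ : ∀ {a b} → 0ℤ ≤ a → 0ℤ ≤ b → a + b ≡ 0ℤ → a ≡ 0ℤ
+-nonNeg-≡0ˡ {a} {b} 0≤a 0≤b a+b≡0 = ≤-antisym
  (subst₂ _≤_ (+-identityʳ a) a+b≡0 (+-monoʳ-≤ a 0≤b)) 0≤a

+-nonNeg-≡0ʳ : ∀ {a b} → 0ℤ ≤ a → 0ℤ ≤ b → a + b ≡ 0ℤ → b ≡ 0ℤ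
+-nonNeg-≡0ʳ {a} {b} 0≤a 0≤b a+b≡0 = +-nonNeg-≡0ˡ 0≤b 0≤a (trans (+-comm b a) a+b≡0)

sum-nonNeg-≡0 : ∀ {n} {f : Vector ℤ n} → (∀ i → 0ℤ ≤ f i) → sum f ≡ 0ℤ → ∀ i → f i ≡ 0ℤ
sum-nonNeg-≡0 0≤f Σf≡0 zero    = +-nonNeg-≡0ˡ (0≤f zero) (sum-nonNeg (0≤f ∘ suc)) Σf≡0
sum-nonNeg-≡0 0≤f Σf≡0 (suc i) =
  sum-nonNeg-≡0 (0≤f ∘ suc) (+-nonNeg-≡0ʳ (0≤f zero) (sum-nonNeg (0≤f ∘ suc)) Σf≡0) i

δ : ∀ {n} → Fin n → Fin n → ℤ
δ i j = ⟦ does (i ≟ j) ⟧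

sum-δ : ∀ {n} (i : Fin n) (f : Vector ℤ n) → sum (λ j → δ i j * f j) ≡ f i
sum-δ {suc n} zero f = begin
  1ℤ * f zero + sum (λ j → 0ℤ * f (suc j)) ≡⟨ cong₂ _+_ (*-identityˡ (f zero)) (sym (*-distribˡ-sum 0ℤ (f ∘ suc))) ⟩
  f zero + 0ℤ * sum (f ∘ suc)              ≡⟨ cong (λ s → f zero + s) (*-zeroˡ (sum (f ∘ suc))) ⟩
  f zero + 0ℤ                              ≡⟨ +-identityʳ (f zero) ⟩
  f zero                                   ∎
sum-δ {suc n} (suc i) f = begin
  0ℤ * f zero + sum (λ j → δ i j * f (suc j)) ≡⟨ cong₂ _+_ (*-zeroˡ (f zero)) (sum-δ i (f ∘ suc)) ⟩
  0ℤ + f (suc i)                              ≡⟨ +-identityˡ (f (suc i)) ⟩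
  f (suc i)                                   ∎

-- Rotation-invariant sums over 5-tuples

∑ᵇ : (Bool → ℤ) → ℤ
∑ᵇ f = f true + f false

∑ᵇ-cong : ∀ {f g : Bool → ℤ} → f ≗ g → ∑ᵇ f ≡ ∑ᵇ g
∑ᵇ-cong f≗g = cong₂ _+_ (f≗g true) (f≗g false)

-- The thirty non-constant binary words of length 5 fall into six rotation
-- classes of five words each.
∑ᵇ-cyclic : (W : Bool → Bool → Bool → Bool → Bool → ℤ) →
  (∀ a b c d e → W a b c d e ≡ W b c d e a) →
  ∃ λ q → (∑ᵇ λ a → ∑ᵇ λ b → ∑ᵇ λ c → ∑ᵇ λ d → ∑ᵇ λ e → W a b c d e)
        ≡ W true true true true true + W false false false false false + + 5 * q
∑ᵇ-cyclic W rot = q , expand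
  where
  pattern t = true
  pattern f = false

  q : ℤ
  q = W t t t t f + W t t t f f + W t t f t f + W t t f f f + W t f t f f + W t f f f f

  expand : (∑ᵇ λ a → ∑ᵇ λ b → ∑ᵇ λ c → ∑ᵇ λ d → ∑ᵇ λ e → W a b c d e)
         ≡ W t t t t t + W f f f f f + + 5 * q
  expand rewrite rot t t t f t | rot t t f t t | rot t f t t t | rot f t t t t
               | rot t t f f t | rot t f f t t | rot f f t t t | rot f t t t f
               | rot t f t f t | rot f t f t t | rot t f t t f | rot f t t f t
               | rot t f f f t | rot f f f t t | rot f f t t f | rot f t t f f
               | rot f t f f t | rot t f f t f | rot f f t f t | rot f t f t f
               | rot f f f f t | rot f f f t f | rot f f t f f | rot f t f f f
    = collect (W t t t t t) (W t t t t f) (W t t t f f) (W t t f t f)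
              (W t t f f f) (W t f t f f) (W t f f f f) (W f f f f f)
    where
    collect : ∀ w₀ w₁ w₂ w₃ w₄ w₅ w₆ w₇ →
      ((((w₀ + w₁) + (w₁ + w₂)) + ((w₁ + w₃) + (w₂ + w₄)))
      + (((w₁ + w₃) + (w₃ + w₅)) + ((w₂ + w₅) + (w₄ + w₆)))) +
      ((((w₁ + w₂) + (w₃ + w₄)) + ((w₃ + w₅) + (w₅ + w₆)))
      + (((w₂ + w₄) + (w₅ + w₆)) + ((w₄ + w₆) + (w₆ + w₇))))
      ≡ w₀ + w₇ + + 5 * (w₁ + w₂ + w₃ + w₄ + w₅ + w₆)
    collect = solve-∀

module CyclicSum {V : Set} (F : V → V → V → V → V → ℤ)
                 (F-rotate : ∀ a b c d e → F a b c d e ≡ F b c d e a) where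

  -- The five families are independent and may differ in length, so that one coordinate at a time
  -- can be confined to part of the point set.
  T : ∀ {i j k l m} → Vector V i → Vector V j → Vector V k → Vector V l → Vector V m → ℤ
  T as bs cs ds es =
    sum λ a → sum λ b → sum λ c → sum λ d → sum λ e → F (as a) (bs b) (cs c) (ds d) (es e)

  -- Four exchanges carry the outermost sum to the innermost place; `F-rotate` then applies term by
  -- term.
  T-rotate : ∀ {i j k l m} (as : Vector V i) (bs : Vector V j) (cs : Vector V k)
             (ds : Vector V l) (es : Vector V m) → T as bs cs ds es ≡ T bs cs ds es as
  T-rotate as bs cs ds es = begin
    (sum λ a → sum λ b → sum λ c → sum λ d → sum λ e → G a b c d e)
      ≡⟨ ∑-comm (λ a b → sum λ c → sum λ d → sum λ e → G a b c d e) ⟩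
    (sum λ b → sum λ a → sum λ c → sum λ d → sum λ e → G a b c d e)
      ≡⟨ (sum-cong-≗ λ b → ∑-comm λ a c → sum λ d → sum λ e → G a b c d e) ⟩
    (sum λ b → sum λ c → sum λ a → sum λ d → sum λ e → G a b c d e)
      ≡⟨ (sum-cong-≗ λ b → sum-cong-≗ λ c → ∑-comm λ a d → sum λ e → G a b c d e) ⟩
    (sum λ b → sum λ c → sum λ d → sum λ a → sum λ e → G a b c d e)
      ≡⟨ (sum-cong-≗ λ b → sum-cong-≗ λ c → sum-cong-≗ λ d → ∑-comm λ a e → G a b c d e) ⟩
    (sum λ b → sum λ c → sum λ d → sum λ e → sum λ a → G a b c d e)
      ≡⟨ (sum-cong-≗ λ b → sum-cong-≗ λ c → sum-cong-≗ λ d → sum-cong-≗ λ e → sum-cong-≗ λ a →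
            F-rotate (as a) (bs b) (cs c) (ds d) (es e)) ⟩
    T bs cs ds es as ∎
    where
    G : Fin _ → Fin _ → Fin _ → Fin _ → Fin _ → ℤ
    G a b c d e = F (as a) (bs b) (cs c) (ds d) (es e)

  module _ {n} (p : Vector V (suc n)) where

    part : (x : Bool) → Vector V (if x then 1 else n)
    part true  = λ _ → head p
    part false = tail p

    -- The block split off at the first place moves to the last, so the next application finds
    -- another unsplit `p` in front. Five applications split every place and restore the original
    -- order.
    T-split : ∀ {j k l m} (bs : Vector V j) (cs : Vector V k) (ds : Vector V l) (es : Vector V m) →
              T p bs cs ds es ≡ ∑ᵇ λ x → T bs cs ds es (part x)
    T-split bs cs ds es = begin
      T p bs cs ds es
        -- `part true` has length 1, so its sum computes to `h + 0ℤ`.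
        ≡⟨ cong (_+ T (tail p) bs cs ds es) (sym (+-identityʳ h)) ⟩
      ∑ᵇ (λ x → T (part x) bs cs ds es)
        ≡⟨ ∑ᵇ-cong (λ x → T-rotate (part x) bs cs ds es) ⟩
      ∑ᵇ (λ x → T bs cs ds es (part x))
        ∎
      where
      h : ℤ
      h = sum λ b → sum λ c → sum λ d → sum λ e → F (head p) (bs b) (cs c) (ds d) (es e)

    T-words : T p p p p p ≡ ∑ᵇ λ a → ∑ᵇ λ b → ∑ᵇ λ c → ∑ᵇ λ d → ∑ᵇ λ e →
                            T (part a) (part b) (part c) (part d) (part e)
    T-words =
      trans (T-split p p p p) (∑ᵇ-cong λ a →
      trans (T-split p p p (part a)) (∑ᵇ-cong λ b →
      trans (T-split p p (part a) (part b)) (∑ᵇ-cong λ c →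
      trans (T-split p (part a) (part b) (part c)) (∑ᵇ-cong λ d →
      T-split (part a) (part b) (part c) (part d)))))

  -- Induction on `n`. A Boolean word records which coordinates are the head of `p`. The
  -- non-constant words contribute a multiple of 5, the all-`true` word contributes `F` at one
  -- repeated point, hence 0, and the all-`false` word is the same sum over the tail.
  T-diagonal : (∀ a → F a a a a a ≡ 0ℤ) → ∀ {n} (p : Vector V n) → ∃ λ q → T p p p p p ≡ + 5 * q
  T-diagonal F-diag {zero}  p = 0ℤ , refl
  T-diagonal F-diag {suc n} p
    with q₁ , eq₁ ← ∑ᵇ-cyclic (λ a b c d e → T (part p a) (part p b) (part p c) (part p d) (part p e))
                      (λ a b c d e → T-rotate (part p a) (part p b) (part p c) (part p d) (part p e))
       | q₂ , eq₂ ← T-diagonal F-diag (tail p) = q₂ + q₁ , (begin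
    T p p p p p                       ≡⟨ trans (T-words p) eq₁ ⟩
    T u u u u u + T r r r r r + + 5 * q₁ ≡⟨ cong (_+ + 5 * q₁) (cong₂ _+_ T-u eq₂) ⟩
    0ℤ + + 5 * q₂ + + 5 * q₁          ≡⟨ cong (_+ + 5 * q₁) (+-identityˡ (+ 5 * q₂)) ⟩
    + 5 * q₂ + + 5 * q₁               ≡⟨ *-distribˡ-+ (+ 5) q₂ q₁ ⟨
    + 5 * (q₂ + q₁)                   ∎)
    where
    u : Vector V 1
    u = part p true

    r : Vector V n
    r = part p false

    T-u : T u u u u u ≡ 0ℤ
    T-u = begin
      T u u u u u                ≡⟨ +-identityʳ _ ⟩
      _                          ≡⟨ +-identityʳ _ ⟩
      _                          ≡⟨ +-identityʳ _ ⟩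
      _                          ≡⟨ +-identityʳ _ ⟩
      _                          ≡⟨ +-identityʳ _ ⟩
      F a a a a a                ≡⟨ F-diag a ⟩
      0ℤ                         ∎
      where
      a : V
      a = head p

-- The Kronecker delta and an integer quadratic.

δ-refl : ∀ {n} (i : Fin n) → δ i i ≡ 1ℤ
δ-refl i = cong ⟦_⟧ (dec-true (i ≟ i) refl)

δ-sym : ∀ {n} (i j : Fin n) → δ i j ≡ δ j i
δ-sym zero    zero    = refl
δ-sym zero    (suc j) = refl
δ-sym (suc i) zero    = refl
δ-sym (suc i) (suc j) = δ-sym i j

sum-δ-1 : ∀ {n} (i : Fin n) → sum (δ i) ≡ 1ℤ
sum-δ-1 i = trans (sum-cong-≗ λ j → sym (*-identityʳ (δ i j))) (sum-δ i (λ _ → 1ℤ))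

-- The roots are -2/3 and 0, and no integer lies strictly between them.
x[3x+2]-nonNeg : ∀ x → 0ℤ ≤ x * (+ 3 * x + + 2)
x[3x+2]-nonNeg (+ n) = subst (0ℤ ≤_) eq (+≤+ z≤n)
  where
  eq : + (n ℕ.* (3 ℕ.* n ℕ.+ 2)) ≡ + n * (+ 3 * + n + + 2)
  eq = trans (pos-* n _) (cong (+ n *_) (trans (pos-+ (3 ℕ.* n) 2) (cong (_+ + 2) (pos-* 3 n))))
x[3x+2]-nonNeg -[1+ n ] = subst (0ℤ ≤_) eq (+≤+ z≤n)
  where
  expand : ∀ m → (1ℤ + m) * (1ℤ + + 3 * m) ≡ - (1ℤ + m) * (+ 3 * - (1ℤ + m) + + 2)
  expand = solve-∀
  eq : + (suc n ℕ.* suc (3 ℕ.* n)) ≡ -[1+ n ] * (+ 3 * -[1+ n ] + + 2)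
  eq = trans (pos-* (suc n) _)
             (trans (cong (λ m → + suc n * (1ℤ + m)) (pos-* 3 n)) (expand (+ n)))

-- An integer root of the other factor would make 3 divide 2.
x[3x+2]≡0⇒x≡0 : ∀ x → x * (+ 3 * x + + 2) ≡ 0ℤ → x ≡ 0ℤ
x[3x+2]≡0⇒x≡0 x eq with i*j≡0⇒i≡0∨j≡0 x eq
... | inj₁ x≡0    = x≡0
... | inj₂ 3x+2≡0 = contradiction (∣⇒∣ᵤ {+ 3} {+ 2} (divides (- x) 2≡-x*3)) (from-no (3 ∣? 2))
  where
  expand : ∀ x → + 2 ≡ + 3 * x + + 2 + - x * + 3
  expand = solve-∀
  2≡-x*3 : + 2 ≡ - x * + 3
  2≡-x*3 = begin
    + 2                      ≡⟨ expand x ⟩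
    + 3 * x + + 2 + - x * + 3 ≡⟨ cong (_+ - x * + 3) 3x+2≡0 ⟩
    0ℤ + - x * + 3           ≡⟨ +-identityˡ (- x * + 3) ⟩
    - x * + 3                ∎

-- Extremal colourings on 4κ + 1 vertices

record IsAdjacency {N} (A : Fin N → Fin N → ℤ) : Set where
  field
    symmetric : ∀ u v → A u v ≡ A v u
    loopless  : ∀ u → A u u ≡ 0ℤ
    zero-one  : ∀ u v → A u v ≡ 0ℤ ⊎ A u v ≡ 1ℤ

_⊡_ : ∀ {N} → (Fin N → Fin N → ℤ) → (Fin N → Fin N → ℤ) → Fin N → Fin N → ℤ
(A ⊡ X) u v = sum λ w → A u w * X w v

complement : ∀ {N} → (Fin N → Fin N → ℤ) → Fin N → Fin N → ℤ
complement A u v = 1ℤ - δ u v - A u v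

module Counting {N} (A : Fin N → Fin N → ℤ) (isAdj : IsAdjacency A) where
  open IsAdjacency isAdj

  -- In graph terms `P u v` counts common neighbours, and `Q u`, below, counts walks of length two
  -- starting at `u`.
  B P : Fin N → Fin N → ℤ
  B = complement A
  P = A ⊡ A

  d Q : Fin N → ℤ
  d u = sum (A u)
  Q u = sum λ w → A u w * d w

  S : ℤ
  S = sum d

  B-symmetric : ∀ u v → B u v ≡ B v u
  B-symmetric u v = cong₂ (λ x y → 1ℤ - x - y) (δ-sym u v) (symmetric u v)

  P-symmetric : ∀ u v → P u v ≡ P v u
  P-symmetric u v = sum-cong-≗ λ w →
    trans (*-comm (A u w) (A w v)) (cong₂ _*_ (symmetric w v) (symmetric u w))

  column-sum : ∀ v → sum (λ u → A u v) ≡ d v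
  column-sum v = sum-cong-≗ λ u → symmetric u v

  P-diagonal : ∀ u → P u u ≡ d u
  P-diagonal u = sum-cong-≗ λ w → trans (cong (A u w *_) (symmetric w u)) (idem (zero-one u w))
    where
    idem : ∀ {x} → x ≡ 0ℤ ⊎ x ≡ 1ℤ → x * x ≡ x
    idem (inj₁ refl) = refl
    idem (inj₂ refl) = refl

  P-row-sum : ∀ u → sum (P u) ≡ Q u
  P-row-sum u = trans (∑-comm λ v w → A u w * A w v)
                      (sum-cong-≗ λ w → sym (*-distribˡ-sum (A u w) (A w)))

  -- After the sums are exchanged, `d v` is counted once for each neighbour of `v`.
  sum-Q : sum Q ≡ sum λ u → d u * d u
  sum-Q = begin
    (sum λ u → sum λ v → A u v * d v) ≡⟨ ∑-comm (λ u v → A u v * d v) ⟩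
    (sum λ v → sum λ u → A u v * d v) ≡⟨ sum-cong-≗ (λ v → sym (*-distribʳ-sum (d v) (λ u → A u v))) ⟩
    (sum λ v → sum (λ u → A u v) * d v) ≡⟨ sum-cong-≗ (λ v → cong (_* d v) (column-sum v)) ⟩
    (sum λ v → d v * d v)             ∎

  B-row-sum : ∀ u → sum (B u) ≡ + N - 1ℤ - d u
  B-row-sum u = begin
    sum (B u)                                 ≡⟨ sum-sub (λ v → 1ℤ - δ u v) (A u) ⟩
    sum (λ v → 1ℤ - δ u v) - d u              ≡⟨ cong (_- d u) (sum-sub (λ _ → 1ℤ) (δ u)) ⟩
    sum {N} (λ _ → 1ℤ) - sum (δ u) - d u      ≡⟨ cong (_- d u) (cong₂ _-_ (trans (sum-const N 1ℤ) (*-identityʳ (+ N))) (sum-δ-1 u)) ⟩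
    + N - 1ℤ - d u                            ∎

  -- As a matrix, `B` is J - I - `A` with J the all-ones matrix; this reduces every product with `B`
  -- to one with `A`.
  B-apply : ∀ u X → (sum λ w → B u w * X w) ≡ sum X - X u - sum λ w → A u w * X w
  B-apply u X = begin
    (sum λ w → B u w * X w)
      ≡⟨ sum-cong-≗ (λ w → expand (δ u w) (A u w) (X w)) ⟩
    (sum λ w → X w - δ u w * X w - A u w * X w)
      ≡⟨ sum-sub (λ w → X w - δ u w * X w) (λ w → A u w * X w) ⟩
    (sum λ w → X w - δ u w * X w) - sum (λ w → A u w * X w)
      ≡⟨ cong (_- sum (λ w → A u w * X w)) (sum-sub X (λ w → δ u w * X w)) ⟩
    sum X - sum (λ w → δ u w * X w) - sum (λ w → A u w * X w)
      ≡⟨ cong (λ s → sum X - s - sum (λ w → A u w * X w)) (sum-δ u X) ⟩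
    sum X - X u - sum (λ w → A u w * X w) ∎
    where
    expand : ∀ i a x → (1ℤ - i - a) * x ≡ x - i * x - a * x
    expand = solve-∀

  AB : ∀ u v → (A ⊡ B) u v ≡ d u - A u v - P u v
  AB u v = begin
    (sum λ w → A u w * B w v) ≡⟨ sum-cong-≗ (λ w → trans (*-comm (A u w) (B w v)) (cong₂ _*_ (B-symmetric w v) (symmetric u w))) ⟩
    (sum λ w → B v w * A w u) ≡⟨ B-apply v (λ w → A w u) ⟩
    sum (λ w → A w u) - A v u - P v u ≡⟨ cong₂ _-_ (cong₂ _-_ (column-sum u) (symmetric v u)) (P-symmetric v u) ⟩
    d u - A u v - P u v       ∎

  -- Turns the bound on codegrees in the complement into one on `P`, which enters here with
  -- coefficient 1.
  BB : ∀ u v → (B ⊡ B) u v ≡ + N - 1ℤ - d v - B u v - (d u - A u v - P u v)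
  BB u v = begin
    (sum λ w → B u w * B w v)                 ≡⟨ B-apply u (λ w → B w v) ⟩
    sum (λ w → B w v) - B u v - (A ⊡ B) u v   ≡⟨ cong₂ (λ s t → s - B u v - t) (trans (sum-cong-≗ λ w → B-symmetric w v) (B-row-sum v)) (AB u v) ⟩
    + N - 1ℤ - d v - B u v - (d u - A u v - P u v) ∎

  trichotomy : ∀ u v → (δ u v ≡ 1ℤ × A u v ≡ 0ℤ) ⊎ (δ u v ≡ 0ℤ × A u v ≡ 0ℤ) ⊎ (δ u v ≡ 0ℤ × A u v ≡ 1ℤ)
  trichotomy u v with u ≟ v
  ... | yes refl = inj₁ (refl , loopless u)
  ... | no _ with zero-one u v
  ...   | inj₁ a≡0 = inj₂ (inj₁ (refl , a≡0))
  ...   | inj₂ a≡1 = inj₂ (inj₂ (refl , a≡1))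

  -- Since `B` is 0-1 valued and its support is disjoint from that of `A`, `B * (B - A)` equals `B`
  -- entrywise; the product here is the difference of the two, which is left over in `E-expand`.
  B[δ+2A]≡0 : ∀ u v → B u v * (δ u v + + 2 * A u v) ≡ 0ℤ
  B[δ+2A]≡0 u v with δ u v | A u v | trichotomy u v
  ... | _ | _ | inj₁ (refl , refl)        = refl
  ... | _ | _ | inj₂ (inj₁ (refl , refl)) = refl
  ... | _ | _ | inj₂ (inj₂ (refl , refl)) = refl

  δP : ∀ u v → δ u v * P u v ≡ δ u v * d u
  δP u v with u ≟ v
  ... | yes refl = cong (1ℤ *_) (P-diagonal u)
  ... | no _     = trans (*-zeroˡ (P u v)) (sym (*-zeroˡ (d u)))

  module Extremal (κ : ℤ) (order : + N ≡ + 4 * κ + 1ℤ)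
                  (A-codegree : ∀ u v → A u v ≡ 1ℤ → P u v ≤ κ - + 2)
                  (B-codegree : ∀ u v → B u v ≡ 1ℤ → (B ⊡ B) u v ≤ κ) where

    -- The slack in whichever codegree bound applies to the pair; on the diagonal both weights
    -- vanish.
    E : Fin N → Fin N → ℤ
    E u v = A u v * (κ - + 2 - P u v) + B u v * (κ - (B ⊡ B) u v)

    E-nonNeg : ∀ u v → 0ℤ ≤ E u v
    E-nonNeg u v = [ diagonal , [ non-edge , edge ]′ ]′ (trichotomy u v)
      where
      p q : ℤ
      p = κ - + 2 - P u v
      q = κ - (B ⊡ B) u v
      E-value : ∀ {i a} → δ u v ≡ i → A u v ≡ a → E u v ≡ a * p + (1ℤ - i - a) * q
      E-value i≡ a≡ = cong₂ (λ i a → a * p + (1ℤ - i - a) * q) i≡ a≡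
      first : ∀ p q → 1ℤ * p + 0ℤ * q ≡ p
      first = solve-∀
      second : ∀ p q → 0ℤ * p + 1ℤ * q ≡ q
      second = solve-∀
      diagonal : δ u v ≡ 1ℤ × A u v ≡ 0ℤ → 0ℤ ≤ E u v
      diagonal (i , a) = ≤-reflexive (sym (E-value i a))
      non-edge : δ u v ≡ 0ℤ × A u v ≡ 0ℤ → 0ℤ ≤ E u v
      non-edge (i , a) = subst (0ℤ ≤_) (sym (trans (E-value i a) (second p q)))
        (i≤j⇒0≤j-i (B-codegree u v (cong₂ (λ x y → 1ℤ - x - y) i a)))
      edge : δ u v ≡ 0ℤ × A u v ≡ 1ℤ → 0ℤ ≤ E u v
      edge (i , a) = subst (0ℤ ≤_) (sym (trans (E-value i a) (first p q)))
        (i≤j⇒0≤j-i (A-codegree u v a))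

    -- Both `A` and `B` multiply `- P u v`, and `A + B` is `1 - δ`, so no product of `A` with `P`
    -- survives. This is the usual count of monochromatic triangles by degrees, done one pair at a
    -- time.
    E-expand : ∀ u v → E u v ≡
      (κ - + 2) * A u v + (κ - + N + + 2 + d u) * B u v + B u v * d v - (P u v - δ u v * P u v)
    E-expand u v = begin
      E u v
        ≡⟨ cong (λ s → A u v * (κ - + 2 - P u v) + B u v * (κ - s)) (BB u v) ⟩
      _
        ≡⟨ expand κ (+ N) (δ u v) (A u v) (P u v) (d u) (d v) ⟩
      F - B u v * (δ u v + + 2 * A u v)
        ≡⟨ cong (λ s → F - s) (B[δ+2A]≡0 u v) ⟩
      F - 0ℤ
        ≡⟨ +-identityʳ F ⟩
      F ∎
      where
      F : ℤ
      F = (κ - + 2) * A u v + (κ - + N + + 2 + d u) * B u v + B u v * d v - (P u v - δ u v * P u v)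
      expand : ∀ κ n i a p x y →
        a * (κ - + 2 - p) + (1ℤ - i - a) * (κ - (n - 1ℤ - y - (1ℤ - i - a) - (x - a - p))) ≡
        (κ - + 2) * a + (κ - n + + 2 + x) * (1ℤ - i - a) + (1ℤ - i - a) * y - (p - i * p)
          - (1ℤ - i - a) * (i + + 2 * a)
      expand = solve-∀

    E-row-sum : ∀ u → sum (E u) ≡
      (κ - + 2) * d u + (κ - + N + + 2 + d u) * (+ N - 1ℤ - d u) + (S - d u - Q u) - (Q u - d u)
    E-row-sum u = begin
      sum (E u)
        ≡⟨ sum-cong-≗ (E-expand u) ⟩
      (sum λ v → a * A u v + b * B u v + B u v * d v - (P u v - δ u v * P u v))
        ≡⟨ sum-sub (λ v → a * A u v + b * B u v + B u v * d v) (λ v → P u v - δ u v * P u v) ⟩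
      (sum λ v → a * A u v + b * B u v + B u v * d v) - (sum λ v → P u v - δ u v * P u v)
        ≡⟨ cong₂ _-_ (∑-distrib-+ (λ v → a * A u v + b * B u v) (λ v → B u v * d v)) (sum-sub (P u) (λ v → δ u v * P u v)) ⟩
      (sum λ v → a * A u v + b * B u v) + (sum λ v → B u v * d v) - (sum (P u) - sum λ v → δ u v * P u v)
        ≡⟨ cong₂ _-_ (cong₂ _+_ (∑-distrib-+ (λ v → a * A u v) (λ v → b * B u v)) (B-apply u d))
                     (cong₂ _-_ (P-row-sum u) (trans (sum-δ u (P u)) (P-diagonal u))) ⟩
      (sum λ v → a * A u v) + (sum λ v → b * B u v) + (S - d u - Q u) - (Q u - d u)
        ≡⟨ cong (λ s → s + (S - d u - Q u) - (Q u - d u))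
             (cong₂ _+_ (sym (*-distribˡ-sum a (A u))) (trans (sym (*-distribˡ-sum b (B u))) (cong (b *_) (B-row-sum u)))) ⟩
      a * d u + b * (+ N - 1ℤ - d u) + (S - d u - Q u) - (Q u - d u) ∎
      where
      a b : ℤ
      a = κ - + 2
      b = κ - + N + + 2 + d u

    x : Fin N → ℤ
    x u = d u - + 2 * κ

    -- The red-triangle counts cancel in the row sums of E, and the remaining terms
    -- cancel against x (3x + 2) after summation over u.
    defect : Fin N → ℤ
    defect u = sum (E u) + x u * (+ 3 * x u + + 2)

    defect-expand : ∀ u → defect u ≡ S - + N * d u + + 2 * (d u * d u - Q u)
    defect-expand u = begin
      defect u ≡⟨ cong (_+ x u * (+ 3 * x u + + 2)) (E-row-sum u) ⟩
      _        ≡⟨ cong (λ n → (κ - + 2) * d u + (κ - n + + 2 + d u) * (n - 1ℤ - d u) + (S - d u - Q u)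
                                - (Q u - d u) + x u * (+ 3 * x u + + 2)) order ⟩
      _        ≡⟨ expand κ (d u) S (Q u) ⟩
      S - (+ 4 * κ + 1ℤ) * d u + + 2 * (d u * d u - Q u)
               ≡⟨ cong (λ n → S - n * d u + + 2 * (d u * d u - Q u)) (sym order) ⟩
      S - + N * d u + + 2 * (d u * d u - Q u) ∎
      where
      expand : ∀ κ y s q →
        (κ - + 2) * y + (κ - (+ 4 * κ + 1ℤ) + + 2 + y) * (+ 4 * κ + 1ℤ - 1ℤ - y) + (s - y - q) - (q - y)
          + (y - + 2 * κ) * (+ 3 * (y - + 2 * κ) + + 2)
        ≡ s - (+ 4 * κ + 1ℤ) * y + + 2 * (y * y - q)
      expand = solve-∀

    defect-sum : sum defect ≡ 0ℤ
    defect-sum = begin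
      sum defect
        ≡⟨ sum-cong-≗ defect-expand ⟩
      (sum λ u → S - + N * d u + + 2 * (d u * d u - Q u))
        ≡⟨ ∑-distrib-+ (λ u → S - + N * d u) (λ u → + 2 * (d u * d u - Q u)) ⟩
      (sum λ u → S - + N * d u) + (sum λ u → + 2 * (d u * d u - Q u))
        ≡⟨ cong₂ _+_ (sum-sub (λ _ → S) (λ u → + N * d u)) (sym (*-distribˡ-sum (+ 2) (λ u → d u * d u - Q u))) ⟩
      sum {N} (λ _ → S) - (sum λ u → + N * d u) + + 2 * (sum λ u → d u * d u - Q u)
        ≡⟨ cong₂ (λ s t → s + + 2 * t) (cong₂ _-_ (sum-const N S) (sym (*-distribˡ-sum (+ N) d)))
                                       (sum-sub (λ u → d u * d u) Q) ⟩
      + N * S - + N * S + + 2 * (S₂ - sum Q)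
        ≡⟨ cong₂ (λ s t → s + + 2 * t) (+-inverseʳ (+ N * S)) (trans (cong (λ s → S₂ - s) sum-Q) (+-inverseʳ S₂)) ⟩
      0ℤ ∎
      where
      S₂ : ℤ
      S₂ = sum λ u → d u * d u

    -- The defects are nonnegative and add up to 0. Equality therefore holds in both summands of
    -- each defect, which gives regularity and the tightness of every codegree bound.
    defect≡0 : ∀ u → defect u ≡ 0ℤ
    defect≡0 = sum-nonNeg-≡0 (λ u → +-mono-≤ (sum-nonNeg (E-nonNeg u)) (x[3x+2]-nonNeg (x u))) defect-sum

    regular : ∀ u → d u ≡ + 2 * κ
    regular u = i-j≡0⇒i≡j (d u) (+ 2 * κ) (x[3x+2]≡0⇒x≡0 (x u)
      (+-nonNeg-≡0ʳ (sum-nonNeg (E-nonNeg u)) (x[3x+2]-nonNeg (x u)) (defect≡0 u)))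

    E≡0 : ∀ u v → E u v ≡ 0ℤ
    E≡0 u = sum-nonNeg-≡0 (E-nonNeg u)
      (+-nonNeg-≡0ˡ (sum-nonNeg (E-nonNeg u)) (x[3x+2]-nonNeg (x u)) (defect≡0 u))

    -- Off the diagonal, the vanishing of `E` is a linear equation that determines `P u v`. On the
    -- diagonal it says nothing, and the value comes from `δP` and the common degree.
    stronglyRegular : ∀ u v → P u v ≡ (κ - 1ℤ) * δ u v - + 3 * A u v + (κ + 1ℤ)
    stronglyRegular u v = begin
      P u v
        ≡⟨ isolate κ (δ u v) (A u v) (P u v) (δ u v * P u v) ⟩
      _
        ≡⟨ cong₂ (λ s t → (t - δ u v * (κ + 1ℤ) - + 3 * A u v + (κ + 1ℤ)) - s) zero-form (trans (δP u v) (cong (δ u v *_) (regular u))) ⟩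
      _
        ≡⟨ collect κ (δ u v) (A u v) ⟩
      (κ - 1ℤ) * δ u v - + 3 * A u v + (κ + 1ℤ) ∎
      where
      form : ℤ → ℤ → ℤ → ℤ
      form n y z = (κ - + 2) * A u v + (κ - n + + 2 + y) * B u v + B u v * z - (P u v - δ u v * P u v)
      zero-form : form (+ 4 * κ + 1ℤ) (+ 2 * κ) (+ 2 * κ) ≡ 0ℤ
      zero-form = begin
        form (+ 4 * κ + 1ℤ) (+ 2 * κ) (+ 2 * κ) ≡⟨ cong₂ (form _) (regular u) (regular v) ⟨
        form (+ 4 * κ + 1ℤ) (d u) (d v)         ≡⟨ cong (λ n → form n (d u) (d v)) order ⟨
        form (+ N) (d u) (d v)                  ≡⟨ E-expand u v ⟨
        E u v                                   ≡⟨ E≡0 u v ⟩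
        0ℤ                                      ∎
      isolate : ∀ κ i a p ip → p ≡ (ip - i * (κ + 1ℤ) - + 3 * a + (κ + 1ℤ)) -
        ((κ - + 2) * a + (κ - (+ 4 * κ + 1ℤ) + + 2 + + 2 * κ) * (1ℤ - i - a) + (1ℤ - i - a) * (+ 2 * κ) - (p - ip))
      isolate = solve-∀
      collect : ∀ κ i a → (i * (+ 2 * κ) - i * (κ + 1ℤ) - + 3 * a + (κ + 1ℤ)) - 0ℤ ≡ (κ - 1ℤ) * i - + 3 * a + (κ + 1ℤ)
      collect = solve-∀

-- Closed walks of length five in a strongly regular graph.

module ClosedWalks {N} (A : Fin N → Fin N → ℤ) (isAdj : IsAdjacency A) (κ : ℤ)
  (regular : ∀ u → sum (A u) ≡ + 2 * κ)
  (stronglyRegular : ∀ u v → (A ⊡ A) u v ≡ (κ - 1ℤ) * δ u v - + 3 * A u v + (κ + 1ℤ)) where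
  open IsAdjacency isAdj

  -- The span of the identity, `A` and the all-ones matrix is closed under multiplication by `A`, so
  -- it contains all the powers needed. The coefficients stand in the type, where they can be
  -- inferred.
  record Combination (X : Fin N → Fin N → ℤ) (α β γ : ℤ) : Set where
    constructor combination
    field entry : ∀ u v → X u v ≡ α * δ u v + β * A u v + γ

  open Combination

  recombine : ∀ {X α α′ β β′ γ γ′} → α ≡ α′ → β ≡ β′ → γ ≡ γ′ →
              Combination X α β γ → Combination X α′ β′ γ′
  recombine refl refl refl X-comb = X-comb

  A⊡-combination : ∀ {X α β γ} → Combination X α β γ →
    Combination (A ⊡ X) (β * (κ - 1ℤ)) (α - + 3 * β) (β * (κ + 1ℤ) + + 2 * κ * γ)
  A⊡-combination {X} {α} {β} {γ} X-comb .entry u v = begin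
    (sum λ w → A u w * X w v)
      ≡⟨ sum-cong-≗ (λ w → trans (cong (A u w *_) (trans (entry X-comb w v) (cong (λ i → α * i + β * A w v + γ) (δ-sym w v))))
                                 (expand (A u w) α (δ v w) β (A w v) γ)) ⟩
    (sum λ w → α * (δ v w * A u w) + β * (A u w * A w v) + γ * A u w)
      ≡⟨ ∑-distrib-+ (λ w → α * (δ v w * A u w) + β * (A u w * A w v)) (λ w → γ * A u w) ⟩
    (sum λ w → α * (δ v w * A u w) + β * (A u w * A w v)) + (sum λ w → γ * A u w)
      ≡⟨ cong₂ _+_ (∑-distrib-+ (λ w → α * (δ v w * A u w)) (λ w → β * (A u w * A w v)))
                   (sym (*-distribˡ-sum γ (A u))) ⟩
    (sum λ w → α * (δ v w * A u w)) + (sum λ w → β * (A u w * A w v)) + γ * sum (A u)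
      ≡⟨ cong₂ (λ s t → s + t + γ * sum (A u)) (sym (*-distribˡ-sum α (λ w → δ v w * A u w)))
                                                (sym (*-distribˡ-sum β (λ w → A u w * A w v))) ⟩
    α * (sum λ w → δ v w * A u w) + β * (A ⊡ A) u v + γ * sum (A u)
      ≡⟨ cong₂ _+_ (cong₂ (λ s t → α * s + β * t) (sum-δ v (A u)) (stronglyRegular u v)) (cong (γ *_) (regular u)) ⟩
    α * A u v + β * ((κ - 1ℤ) * δ u v - + 3 * A u v + (κ + 1ℤ)) + γ * (+ 2 * κ)
      ≡⟨ collect α β γ κ (δ u v) (A u v) ⟩
    β * (κ - 1ℤ) * δ u v + (α - + 3 * β) * A u v + (β * (κ + 1ℤ) + + 2 * κ * γ) ∎
    where
    expand : ∀ a α i β b γ → a * (α * i + β * b + γ) ≡ α * (i * a) + β * (a * b) + γ * a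
    expand = solve-∀
    collect : ∀ α β γ κ i a → α * a + β * ((κ - 1ℤ) * i - + 3 * a + (κ + 1ℤ)) + γ * (+ 2 * κ)
                            ≡ β * (κ - 1ℤ) * i + (α - + 3 * β) * a + (β * (κ + 1ℤ) + + 2 * κ * γ)
    collect = solve-∀

  A⁵ : Fin N → Fin N → ℤ
  A⁵ = A ⊡ (A ⊡ (A ⊡ (A ⊡ A)))

  closedWalks : ℤ
  closedWalks = + 8 * (κ * κ * κ * κ) - + 2 * (κ * κ * κ) - + 6 * (κ * κ) - + 26 * κ

  A²-combination : Combination (A ⊡ A) (κ - 1ℤ) (- + 3) (κ + 1ℤ)
  A²-combination .entry u v = trans (stronglyRegular u v)
    (cong (λ s → (κ - 1ℤ) * δ u v + s + (κ + 1ℤ)) (neg-distribˡ-* (+ 3) (A u v)))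

  A³-combination : Combination (A ⊡ (A ⊡ A)) (- + 3 * (κ - 1ℤ)) (κ + + 8) (+ 2 * (κ * κ) - κ - + 3)
  A³-combination = recombine refl (β κ) (γ κ) (A⊡-combination A²-combination)
    where
    β : ∀ κ → κ - 1ℤ - + 3 * - + 3 ≡ κ + + 8
    β = solve-∀
    γ : ∀ κ → - + 3 * (κ + 1ℤ) + + 2 * κ * (κ + 1ℤ) ≡ + 2 * (κ * κ) - κ - + 3
    γ = solve-∀

  A⁴-combination : Combination (A ⊡ (A ⊡ (A ⊡ A)))
    ((κ + + 8) * (κ - 1ℤ)) (- + 6 * κ - + 21) (+ 4 * (κ * κ * κ) - κ * κ + + 3 * κ + + 8)
  A⁴-combination = recombine refl (β κ) (γ κ) (A⊡-combination A³-combination)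
    where
    β : ∀ κ → - + 3 * (κ - 1ℤ) - + 3 * (κ + + 8) ≡ - + 6 * κ - + 21
    β = solve-∀
    γ : ∀ κ → (κ + + 8) * (κ + 1ℤ) + + 2 * κ * (+ 2 * (κ * κ) - κ - + 3)
            ≡ + 4 * (κ * κ * κ) - κ * κ + + 3 * κ + + 8
    γ = solve-∀

  A⁵-diagonal : ∀ u → A⁵ u u ≡ closedWalks
  A⁵-diagonal u = begin
    A⁵ u u
      ≡⟨ entry (A⊡-combination A⁴-combination) u u ⟩
    α * δ u u + β * A u u + γ
      ≡⟨ cong₂ (λ i a → α * i + β * a + γ) (δ-refl u) (loopless u) ⟩
    α * 1ℤ + β * 0ℤ + γ
      ≡⟨ cong (λ s → α * 1ℤ + s + γ) (*-zeroʳ β) ⟩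
    α * 1ℤ + 0ℤ + γ
      ≡⟨ collect κ ⟩
    closedWalks ∎
    where
    α β γ : ℤ
    α = (- + 6 * κ - + 21) * (κ - 1ℤ)
    β = (κ + + 8) * (κ - 1ℤ) - + 3 * (- + 6 * κ - + 21)
    γ = (- + 6 * κ - + 21) * (κ + 1ℤ) + + 2 * κ * (+ 4 * (κ * κ * κ) - κ * κ + + 3 * κ + + 8)
    collect : ∀ κ →
      (- + 6 * κ - + 21) * (κ - 1ℤ) * 1ℤ + 0ℤ +
        ((- + 6 * κ - + 21) * (κ + 1ℤ) + + 2 * κ * (+ 4 * (κ * κ * κ) - κ * κ + + 3 * κ + + 8))
      ≡ + 8 * (κ * κ * κ * κ) - + 2 * (κ * κ * κ) - + 6 * (κ * κ) - + 26 * κ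
    collect = solve-∀

  walk : Fin N → Fin N → Fin N → Fin N → Fin N → ℤ
  walk a b c d e = A a b * (A b c * (A c d * (A d e * A e a)))

  walk-rotate : ∀ a b c d e → walk a b c d e ≡ walk b c d e a
  walk-rotate a b c d e = expand (A a b) (A b c) (A c d) (A d e) (A e a)
    where
    expand : ∀ v w x y z → v * (w * (x * (y * z))) ≡ w * (x * (y * (z * v)))
    expand = solve-∀

  walk-diagonal : ∀ a → walk a a a a a ≡ 0ℤ
  walk-diagonal a = trans (cong (_* w) (loopless a)) (*-zeroˡ w)
    where
    w : ℤ
    w = A a a * (A a a * (A a a * A a a))

  open CyclicSum walk walk-rotate

  -- Each factor is carried inward past the sums to its right, one sum at a time; `walk` is nested
  -- to the right to match `A⁵`.
  trace-A⁵ : sum (λ u → A⁵ u u) ≡ T id id id id id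
  trace-A⁵ = sum-cong-≗ λ a → sum-cong-≗ λ b →
    trans (*-distribˡ-sum (A a b) λ c → A b c * (sum λ d → A c d * (sum λ e → A d e * A e a))) (sum-cong-≗ λ c →
    trans (cong (A a b *_) (*-distribˡ-sum (A b c) λ d → A c d * (sum λ e → A d e * A e a)))
    (trans (*-distribˡ-sum (A a b) λ d → A b c * (A c d * (sum λ e → A d e * A e a))) (sum-cong-≗ λ d →
    trans (cong (λ s → A a b * (A b c * s)) (*-distribˡ-sum (A c d) λ e → A d e * A e a))
    (trans (cong (A a b *_) (*-distribˡ-sum (A b c) λ e → A c d * (A d e * A e a)))
    (*-distribˡ-sum (A a b) λ e → A b c * (A c d * (A d e * A e a)))))))

  -- tr A⁵ = (4κ + 1) (8κ⁴ - 2κ³ - 6κ² - 26κ), and κ times this is -32 modulo 5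
  -- as soon as κ² = -1 modulo 5.
  impossible : + N ≡ + 4 * κ + 1ℤ → ∀ m → κ * κ + 1ℤ ≡ + 5 * m → ⊥
  impossible order m κ²+1≡5m
    with q , T≡5q ← T-diagonal walk-diagonal id
    = from-no (5 ∣? 32) (∣⇒∣ᵤ {+ 5} {+ 32} (divides z (begin
      + 32
        ≡⟨ isolate κ ⟩
      (κ * κ + 1ℤ) * h + + 110 * κ - κ * ((+ 4 * κ + 1ℤ) * closedWalks)
        ≡⟨ cong₂ (λ s t → s * h + + 110 * κ - κ * t) κ²+1≡5m count ⟩
      + 5 * m * h + + 110 * κ - κ * (+ 5 * q)
        ≡⟨ collect m h κ q ⟩
      z * + 5 ∎)))
    where
    -- `h` is the quotient of `κ * ((+ 4 * κ + 1ℤ) * closedWalks)` on division by `κ * κ + 1ℤ`; the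
    -- remainder is 110κ - 32, and 110 is a multiple of 5.
    h z : ℤ
    h = + 32 * (κ * κ * κ * κ) - + 58 * (κ * κ) + + 32 - + 110 * κ
    z = m * h + + 22 * κ - κ * q
    count : (+ 4 * κ + 1ℤ) * closedWalks ≡ + 5 * q
    count = begin
      (+ 4 * κ + 1ℤ) * closedWalks ≡⟨ cong (_* closedWalks) (sym order) ⟩
      + N * closedWalks            ≡⟨ sum-const N closedWalks ⟨
      sum {N} (λ _ → closedWalks)  ≡⟨ sum-cong-≗ (λ u → sym (A⁵-diagonal u)) ⟩
      sum (λ u → A⁵ u u)           ≡⟨ trans trace-A⁵ T≡5q ⟩
      + 5 * q                      ∎
    isolate : ∀ κ → + 32 ≡ (κ * κ + 1ℤ) * (+ 32 * (κ * κ * κ * κ) - + 58 * (κ * κ) + + 32 - + 110 * κ) + + 110 * κ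
      - κ * ((+ 4 * κ + 1ℤ) * (+ 8 * (κ * κ * κ * κ) - + 2 * (κ * κ * κ) - + 6 * (κ * κ) - + 26 * κ))
    isolate = solve-∀
    collect : ∀ m h κ q → + 5 * m * h + + 110 * κ - κ * (+ 5 * q) ≡ (m * h + + 22 * κ - κ * q) * + 5
    collect = solve-∀

no-extremal-graph : ∀ {N} (A : Fin N → Fin N → ℤ) → IsAdjacency A → ∀ κ m →
  + N ≡ + 4 * κ + 1ℤ → κ * κ + 1ℤ ≡ + 5 * m →
  (∀ u v → A u v ≡ 1ℤ → (A ⊡ A) u v ≤ κ - + 2) →
  (∀ u v → complement A u v ≡ 1ℤ → (complement A ⊡ complement A) u v ≤ κ) → ⊥
no-extremal-graph A isAdj κ m order κ²+1≡5m A-codegree B-codegree =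
  ClosedWalks.impossible A isAdj κ regular stronglyRegular order m κ²+1≡5m
  where open Counting.Extremal A isAdj κ order A-codegree B-codegree

-- Books and common neighbours

⟦⟧-∧ : ∀ a b → ⟦ a ∧ b ⟧ ≡ ⟦ a ⟧ * ⟦ b ⟧
⟦⟧-∧ true  b = sym (*-identityˡ ⟦ b ⟧)
⟦⟧-∧ false b = sym (*-zeroˡ ⟦ b ⟧)

⟦⟧-01 : ∀ b → ⟦ b ⟧ ≡ 0ℤ ⊎ ⟦ b ⟧ ≡ 1ℤ
⟦⟧-01 true  = inj₂ refl
⟦⟧-01 false = inj₁ refl

⟦does⟧≡1⇒ : ∀ {P : Set} (P? : Dec P) → ⟦ does P? ⟧ ≡ 1ℤ → P
⟦does⟧≡1⇒ (yes p) _ = p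

lookup-injective : ∀ {A : Set} {xs : List A} → Unique xs → Injective _≡_ _≡_ (lookup xs)
lookup-injective (x∉xs ∷ _) {zero}  {zero}  _  = refl
lookup-injective (x∉xs ∷ _) {zero}  {suc j} eq = contradiction eq (All.lookup x∉xs (∈-lookup j))
lookup-injective (x∉xs ∷ _) {suc i} {zero}  eq = contradiction (sym eq) (All.lookup x∉xs (∈-lookup i))
lookup-injective (_ ∷ xs!)  {suc i} {suc j} eq = cong suc (lookup-injective xs! eq)

module _ {N} {P : Pred (Fin N) 0ℓ} (P? : Decidable P) where

  -- The length of a duplicate-free list, so that list positions translate between cardinality
  -- bounds and injections.
  count : ℕ
  count = length (filter P? (allFin N))

  sum-indicator : sum (λ w → ⟦ does (P? w) ⟧) ≡ + count
  sum-indicator = go id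
    where
    -- `allFin` is `tabulate id`; the induction needs an arbitrary `φ`, since each step composes it
    -- with `suc`.
    go : ∀ {n} (φ : Fin n → Fin N) → sum (λ i → ⟦ does (P? (φ i)) ⟧) ≡ + length (filter P? (tabulate φ))
    go {zero}  φ = refl
    go {suc n} φ with does (P? (φ zero))
    ... | true  = cong (λ s → 1ℤ + s) (go (φ ∘ suc))
    ... | false = trans (+-identityˡ _) (go (φ ∘ suc))

  injection⇒≤count : ∀ {m} (f : Fin m → Fin N) → Injective _≡_ _≡_ f → (∀ i → P (f i)) → m ℕ.≤ count
  injection⇒≤count f f-inj Pf = injective⇒≤ {f = Any.index ∘ member} λ {i} {j} eq →
    f-inj (trans (lookup-index (member i)) (trans (cong (lookup (filter P? (allFin N))) eq) (sym (lookup-index (member j)))))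
    where
    member : ∀ i → f i ∈ filter P? (allFin N)
    member i = ∈-filter⁺ P? (∈-allFin (f i)) (Pf i)

  ≤count⇒injection : ∀ {m} → m ℕ.≤ count →
    ∃ λ (f : Fin m → Fin N) → Injective _≡_ _≡_ f × (∀ i → P (f i))
  ≤count⇒injection {m} m≤ = f , f-inj , λ i → proj₂ (∈-filter⁻ P? {xs = allFin N} (∈-lookup (inject≤ i m≤)))
    where
    f : Fin m → Fin N
    f i = lookup (filter P? (allFin N)) (inject≤ i m≤)
    f-inj : Injective _≡_ _≡_ f
    f-inj {i} {j} eq = inject≤-injective m≤ m≤ i j
      (lookup-injective (filter⁺ P? (allFin⁺ N)) eq)

_≟ᶜ_ : (c c′ : Colour) → Dec (c ≡ c′)
red  ≟ᶜ red  = yes refl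
red  ≟ᶜ blue = no λ ()
blue ≟ᶜ red  = no λ ()
blue ≟ᶜ blue = yes refl

module _ {N} (χ : Colouring N) where

  Adjacent : Colour → Fin N → Fin N → Set
  Adjacent c = Adj (colourGraph χ c)

  adjacent? : ∀ c u v → Dec (Adjacent c u v)
  adjacent? c u v = ¬? (u ≟ v) ×-dec (colour χ u v ≟ᶜ c)

  commonNeighbour? : ∀ c u v → Decidable (λ w → Adjacent c u w × Adjacent c w v)
  commonNeighbour? c u v w = adjacent? c u w ×-dec adjacent? c w v

  codegree : Colour → Fin N → Fin N → ℕ
  codegree c u v = count (commonNeighbour? c u v)

  matrix : Colour → Fin N → Fin N → ℤ
  matrix c u v = ⟦ does (adjacent? c u v) ⟧

  matrix² : ∀ c u v → (matrix c ⊡ matrix c) u v ≡ + codegree c u v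
  matrix² c u v = trans
    (sum-cong-≗ λ w → sym (⟦⟧-∧ (does (adjacent? c u w)) (does (adjacent? c w v))))
    (sum-indicator (commonNeighbour? c u v))

  matrix-isAdjacency : ∀ c → IsAdjacency (matrix c)
  matrix-isAdjacency c = record
    { symmetric = λ u v → trans
        (⟦⟧-∧ (does (¬? (u ≟ v))) (does (colour χ u v ≟ᶜ c)))
        (trans (cong₂ _*_ (δᶜ-sym u v) (cong (λ c′ → ⟦ does (c′ ≟ᶜ c) ⟧) (colour-sym χ u v)))
        (sym (⟦⟧-∧ (does (¬? (v ≟ u))) (does (colour χ v u ≟ᶜ c)))))
    ; loopless = λ u → cong ⟦_⟧ (dec-false (adjacent? c u u) λ (u≢u , _) → u≢u refl)
    ; zero-one = λ u v → ⟦⟧-01 (does (adjacent? c u v))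
    }
    where
    ⟦not⟧ : ∀ {P : Set} (P? : Dec P) → ⟦ does (¬? P?) ⟧ ≡ 1ℤ - ⟦ does P? ⟧
    ⟦not⟧ (yes _) = refl
    ⟦not⟧ (no _)  = refl
    δᶜ-sym : ∀ u v → ⟦ does (¬? (u ≟ v)) ⟧ ≡ ⟦ does (¬? (v ≟ u)) ⟧
    δᶜ-sym u v = trans (⟦not⟧ (u ≟ v)) (trans (cong (λ x → 1ℤ - x) (δ-sym u v)) (sym (⟦not⟧ (v ≟ u))))

  complement-red : ∀ u v → complement (matrix red) u v ≡ matrix blue u v
  complement-red u v with u ≟ v
  ... | yes _ = refl
  ... | no _ with colour χ u v
  ...   | red  = refl
  ...   | blue = refl

  Contains-book : ∀ {c m u v} → Adjacent c u v → m ℕ.≤ codegree c u v → Contains (colourGraph χ c) (book m)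
  Contains-book {c} {m} {u} {v} uv m≤ with w , w-inj , uwv ← ≤count⇒injection (commonNeighbour? c u v) m≤ =
    f , (λ {x} {y} → f-inj x y) , f-adj
    where
    f : Vertex (book m) → Fin N
    f (inj₁ zero)       = u
    f (inj₁ (suc zero)) = v
    f (inj₂ i)          = w i

    f-adj : ∀ x y → Adj (book m) x y → Adjacent c (f x) (f y)
    f-adj (inj₁ zero)       (inj₁ zero)       0≢0 = contradiction refl 0≢0
    f-adj (inj₁ zero)       (inj₁ (suc zero)) _   = uv
    f-adj (inj₁ (suc zero)) (inj₁ zero)       _   = adj-sym (colourGraph χ c) uv
    f-adj (inj₁ (suc zero)) (inj₁ (suc zero)) 1≢1 = contradiction refl 1≢1
    f-adj (inj₁ zero)       (inj₂ i)          _   = proj₁ (uwv i)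
    f-adj (inj₁ (suc zero)) (inj₂ i)          _   = adj-sym (colourGraph χ c) (proj₂ (uwv i))
    f-adj (inj₂ i)          (inj₁ zero)       _   = adj-sym (colourGraph χ c) (proj₁ (uwv i))
    f-adj (inj₂ i)          (inj₁ (suc zero)) _   = proj₂ (uwv i)

    f-inj : ∀ x y → f x ≡ f y → x ≡ y
    f-inj (inj₁ zero)       (inj₁ zero)       _  = refl
    f-inj (inj₁ zero)       (inj₁ (suc zero)) eq = contradiction eq (proj₁ uv)
    f-inj (inj₁ (suc zero)) (inj₁ zero)       eq = contradiction (sym eq) (proj₁ uv)
    f-inj (inj₁ (suc zero)) (inj₁ (suc zero)) _  = refl
    f-inj (inj₁ zero)       (inj₂ i)          eq = contradiction eq (proj₁ (proj₁ (uwv i)))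
    f-inj (inj₁ (suc zero)) (inj₂ i)          eq = contradiction (sym eq) (proj₁ (proj₂ (uwv i)))
    f-inj (inj₂ i)          (inj₁ zero)       eq = contradiction (sym eq) (proj₁ (proj₁ (uwv i)))
    f-inj (inj₂ i)          (inj₁ (suc zero)) eq = contradiction eq (proj₁ (proj₂ (uwv i)))
    f-inj (inj₂ i)          (inj₂ j)          eq = cong inj₂ (w-inj eq)

  -- A finite search for a spine with enough common neighbours makes the dichotomy constructive.
  book-or-small-codegree : ∀ c m → Contains (colourGraph χ c) (book m) ⊎
                           (∀ u v → Adjacent c u v → codegree c u v ℕ.< m)
  book-or-small-codegree c m with any? (λ u → any? λ v → adjacent? c u v ×-dec (m ℕ.≤? codegree c u v))
  ... | yes (u , v , uv , m≤) = inj₁ (Contains-book uv m≤)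
  ... | no ¬large             = inj₂ λ u v uv → ℕ.≰⇒> λ m≤ → ¬large (u , v , uv , m≤)

-- Here κ is `suc k`. Without a red book of k pages, red codegrees on red edges are at most k - 1 =
-- κ - 2; without a blue book of k + 2 pages, blue codegrees on blue edges are at most k + 1 = κ.
arrows : ∀ k m → + suc k * + suc k + 1ℤ ≡ + 5 * m →
         Arrows (suc (4 ℕ.* suc k)) (book k) (book (suc (suc k)))
arrows k m κ²+1≡5m χ with book-or-small-codegree χ red k | book-or-small-codegree χ blue (suc (suc k))
... | inj₁ red-book  | _              = inj₁ red-book
... | inj₂ _         | inj₁ blue-book = inj₂ blue-book
... | inj₂ red-small | inj₂ blue-small = ⊥-elim
  (no-extremal-graph (matrix χ red) (matrix-isAdjacency χ red) (+ suc k) m order κ²+1≡5m red-codegree blue-codegree)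
  where
  order : + suc (4 ℕ.* suc k) ≡ + 4 * + suc k + 1ℤ
  order = trans (+-comm 1ℤ (+ (4 ℕ.* suc k))) (cong (_+ 1ℤ) (pos-* 4 (suc k)))

  red-codegree : ∀ u v → matrix χ red u v ≡ 1ℤ → (matrix χ red ⊡ matrix χ red) u v ≤ + suc k - + 2
  -- `red-small` bounds the codegree plus 1 by `k`; subtracting 1 in ℤ avoids truncation at `k` = 0.
  red-codegree u v eq = subst₂ _≤_ (trans (shift (+ codegree χ red u v)) (sym (matrix² χ red u v)))
    (shift′ (+ k)) (+-monoˡ-≤ -1ℤ (+≤+ (red-small u v (⟦does⟧≡1⇒ (adjacent? χ red u v) eq))))
    where
    shift : ∀ x → 1ℤ + x + -1ℤ ≡ x
    shift = solve-∀
    shift′ : ∀ x → x + -1ℤ ≡ 1ℤ + x - + 2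
    shift′ = solve-∀

  blue-codegree : ∀ u v → complement (matrix χ red) u v ≡ 1ℤ →
                  (complement (matrix χ red) ⊡ complement (matrix χ red)) u v ≤ + suc k
  blue-codegree u v eq = subst (_≤ + suc k)
    (trans (sym (matrix² χ blue u v)) (sum-cong-≗ λ w → sym (cong₂ _*_ (complement-red χ u w) (complement-red χ w v))))
    (+≤+ (ℕ.s≤s⁻¹ (blue-small u v (⟦does⟧≡1⇒ (adjacent? χ blue u v) (trans (sym (complement-red χ u v)) eq)))))

-- Hadamard matrices

sum-++ : ∀ m {n} (f : Vector ℤ (m ℕ.+ n)) →
         sum f ≡ sum (λ i → f (i ↑ˡ n)) + sum (λ j → f (m ↑ʳ j))
sum-++ zero    f = sym (+-identityˡ (sum f))
sum-++ (suc m) {n} f = begin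
  f zero + sum (f ∘ suc)   ≡⟨ cong (λ s → f zero + s) (sum-++ m (f ∘ suc)) ⟩
  f zero + (sum (λ i → f (suc (i ↑ˡ n))) + sum (λ j → f (suc m ↑ʳ j)))
                           ≡⟨ +-assoc (f zero) (sum λ i → f (suc (i ↑ˡ n))) (sum λ j → f (suc m ↑ʳ j)) ⟨
  f zero + sum (λ i → f (suc (i ↑ˡ n))) + sum (λ j → f (suc m ↑ʳ j)) ∎

sum-combine : ∀ m {n} (f : Vector ℤ (m ℕ.* n)) → sum f ≡ sum λ i → sum λ j → f (combine {m} {n} i j)
sum-combine zero    f = refl
sum-combine (suc m) {n} f = begin
  sum f ≡⟨ sum-++ n f ⟩
  sum (λ j → f (j ↑ˡ m ℕ.* n)) + sum (λ i → f (n ↑ʳ i))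
        ≡⟨ cong (λ s → sum (λ j → f (j ↑ˡ m ℕ.* n)) + s) (sum-combine m (λ i → f (n ↑ʳ i))) ⟩
  (sum λ i → sum λ j → f (combine {suc m} {n} i j)) ∎

-- Sign matrices are written with colours as entries: red for 1 and blue for -1.
Matrix : ℕ → Set
Matrix n = Fin n → Fin n → Colour

σ : Colour → ℤ
σ red  = 1ℤ
σ blue = -1ℤ

_·_ : Colour → Colour → Colour
red  · c    = c
blue · red  = blue
blue · blue = red

σ-· : ∀ c c′ → σ (c · c′) ≡ σ c * σ c′
σ-· red  red  = refl
σ-· red  blue = refl
σ-· blue red  = refl
σ-· blue blue = refl

σ-square : ∀ c → σ c * σ c ≡ 1ℤ
σ-square red  = refl
σ-square blue = refl

rowSum : ∀ {n} → Matrix n → Fin n → ℤ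
rowSum M u = sum λ w → σ (M u w)

gram : ∀ {n} → Matrix n → Fin n → Fin n → ℤ
gram M u v = sum λ w → σ (M u w) * σ (M v w)

gram-diagonal : ∀ {n} (M : Matrix n) u → gram M u u ≡ + n
gram-diagonal {n} M u = begin
  gram M u u            ≡⟨ sum-cong-≗ (λ w → σ-square (M u w)) ⟩
  sum {n} (λ _ → 1ℤ)    ≡⟨ sum-const n 1ℤ ⟩
  + n * 1ℤ              ≡⟨ *-identityʳ (+ n) ⟩
  + n                   ∎

record IsRedDiagonal {n} (M : Matrix n) : Set where
  field
    symmetric : ∀ u v → M u v ≡ M v u
    diagonal  : ∀ u → M u u ≡ red

Orthogonal : ∀ {n} → Matrix n → Set
Orthogonal M = ∀ {u v} → u ≢ v → gram M u v ≡ 0ℤ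

module _ {m n} (M : Matrix m) (M′ : Matrix n) where

  private
    q : Fin (m ℕ.* n) → Fin m
    q = quotient n
    r : Fin (m ℕ.* n) → Fin n
    r = remainder {m} n

  infixl 7 _⊗_
  -- The Kronecker product of sign matrices, with index pairs coded by quotient and remainder.
  _⊗_ : Matrix (m ℕ.* n)
  _⊗_ u v = M (q u) (q v) · M′ (r u) (r v)

  σ-⊗-combine : ∀ u i j → σ (_⊗_ u (combine {m} {n} i j)) ≡ σ (M (q u) i) * σ (M′ (r u) j)
  σ-⊗-combine u i j = trans
    (cong (λ (i , j) → σ (M (q u) i · M′ (r u) j)) (remQuot-combine {m} {n} i j))
    (σ-· (M (q u) i) (M′ (r u) j))

  rowSum-⊗ : ∀ u → rowSum _⊗_ u ≡ rowSum M (q u) * rowSum M′ (r u)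
  rowSum-⊗ u = begin
    rowSum _⊗_ u
      ≡⟨ sum-combine m (λ w → σ (_⊗_ u w)) ⟩
    (sum λ i → sum λ j → σ (_⊗_ u (combine {m} {n} i j)))
      ≡⟨ (sum-cong-≗ λ i → trans (sum-cong-≗ (σ-⊗-combine u i)) (sym (*-distribˡ-sum (σ (M (q u) i)) (λ j → σ (M′ (r u) j))))) ⟩
    (sum λ i → σ (M (q u) i) * rowSum M′ (r u))
      ≡⟨ *-distribʳ-sum (rowSum M′ (r u)) (λ i → σ (M (q u) i)) ⟨
    rowSum M (q u) * rowSum M′ (r u) ∎

  -- Summing over columns as pairs separates the two factors.
  gram-⊗ : ∀ u v → gram _⊗_ u v ≡
           gram M (q u) (q v) * gram M′ (r u) (r v)
  gram-⊗ u v = begin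
    gram _⊗_ u v
      ≡⟨ sum-combine m (λ w → σ (_⊗_ u w) * σ (_⊗_ v w)) ⟩
    (sum λ i → sum λ j → σ (_⊗_ u (combine {m} {n} i j)) * σ (_⊗_ v (combine {m} {n} i j)))
      ≡⟨ (sum-cong-≗ λ i → trans
            (sum-cong-≗ λ j → trans (cong₂ _*_ (σ-⊗-combine u i j) (σ-⊗-combine v i j))
                                    (interchange (σ (M (q u) i)) (σ (M′ (r u) j)) (σ (M (q v) i)) (σ (M′ (r v) j))))
            (sym (*-distribˡ-sum (σ (M (q u) i) * σ (M (q v) i)) (λ j → σ (M′ (r u) j) * σ (M′ (r v) j))))) ⟩
    (sum λ i → σ (M (q u) i) * σ (M (q v) i) * gram M′ (r u) (r v))
      ≡⟨ *-distribʳ-sum (gram M′ (r u) (r v)) (λ i → σ (M (q u) i) * σ (M (q v) i)) ⟨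
    gram M (q u) (q v) * gram M′ (r u) (r v) ∎
    where
    interchange : ∀ a b c d → a * b * (c * d) ≡ a * c * (b * d)
    interchange = solve-∀

  ⊗-isRedDiagonal : IsRedDiagonal M → IsRedDiagonal M′ → IsRedDiagonal _⊗_
  ⊗-isRedDiagonal isM isM′ = record
    { symmetric = λ u v → cong₂ _·_ (symmetric isM _ _) (symmetric isM′ _ _)
    ; diagonal  = λ u → cong₂ _·_ (diagonal isM _) (diagonal isM′ _)
    }
    where open IsRedDiagonal

  quotient-remainder-≢ : ∀ {u v} → u ≢ v → r u ≡ r v → q u ≢ q v
  quotient-remainder-≢ {u} {v} u≢v r≡ q≡ = u≢v (begin
    u                                              ≡⟨ combine-remQuot {m} n u ⟨
    combine (q u) (r u) ≡⟨ cong₂ combine q≡ r≡ ⟩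
    combine (q v) (r v) ≡⟨ combine-remQuot {m} n v ⟩
    v                                              ∎)

  -- Distinct indices differ in the remainder or in the quotient, and the corresponding factor of
  -- the inner product vanishes.
  ⊗-orthogonal : Orthogonal M → Orthogonal M′ → Orthogonal _⊗_
  ⊗-orthogonal M⊥ M′⊥ {u} {v} u≢v = trans (gram-⊗ u v) product≡0
    where
    product≡0 : gram M (q u) (q v) * gram M′ (r u) (r v) ≡ 0ℤ
    product≡0 with r u ≟ r v
    ... | no  r≢ = trans (cong (gram M _ _ *_) (M′⊥ r≢)) (*-zeroʳ (gram M (q u) (q v)))
    ... | yes r≡ = trans (cong (_* gram M′ _ _) (M⊥ (quotient-remainder-≢ u≢v r≡)))
                         (*-zeroˡ (gram M′ (r u) (r v)))

-- The all-ones matrix minus twice the antidiagonal permutation matrix, a Hadamard matrix. As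
-- `opposite` has no fixed point on `Fin 4`, the diagonal is red.
H₄ : Matrix 4
H₄ u v = if does (v ≟ opposite u) then blue else red

H₄-isRedDiagonal : IsRedDiagonal H₄
H₄-isRedDiagonal = record
  { symmetric = from-yes (all? λ u → all? λ v → H₄ u v ≟ᶜ H₄ v u)
  ; diagonal  = from-yes (all? λ u → H₄ u u ≟ᶜ red)
  }

H₄-orthogonal : Orthogonal H₄
H₄-orthogonal {u} {v} u≢v =
  [ (λ u≡v → contradiction u≡v u≢v) , id ]′
    (from-yes (all? λ u → all? λ v → (u ≟ v) ⊎-dec (gram H₄ u v ℤ.≟ 0ℤ)) u v)

H : ∀ ℓ → Matrix (4 ℕ.^ ℓ)
H zero    u v = red
H (suc ℓ)     = H₄ ⊗ H ℓ

H-isRedDiagonal : ∀ ℓ → IsRedDiagonal (H ℓ)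
H-isRedDiagonal zero    = record { symmetric = λ _ _ → refl ; diagonal = λ _ → refl }
H-isRedDiagonal (suc ℓ) = ⊗-isRedDiagonal H₄ (H ℓ) H₄-isRedDiagonal (H-isRedDiagonal ℓ)

H-orthogonal : ∀ ℓ → Orthogonal (H ℓ)
H-orthogonal zero    {zero} {zero} 0≢0 = contradiction refl 0≢0
H-orthogonal (suc ℓ) = ⊗-orthogonal H₄ (H ℓ) H₄-orthogonal (H-orthogonal ℓ)

K₂ : Matrix 2
K₂ u v = if does (u ≟ v) then red else blue

K₂-isRedDiagonal : IsRedDiagonal K₂
K₂-isRedDiagonal = record
  { symmetric = from-yes (all? λ u → all? λ v → K₂ u v ≟ᶜ K₂ v u)
  ; diagonal  = from-yes (all? λ u → K₂ u u ≟ᶜ red)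
  }

K₂-gram : ∀ {u v} → u ≢ v → gram K₂ u v ≡ - + 2
K₂-gram {u} {v} u≢v =
  [ (λ u≡v → contradiction u≡v u≢v) , id ]′
    (from-yes (all? λ u → all? λ v → (u ≟ v) ⊎-dec (gram K₂ u v ℤ.≟ - + 2)) u v)

K₂-rowSum : ∀ u → rowSum K₂ u ≡ 0ℤ
K₂-rowSum = from-yes (all? λ u → rowSum K₂ u ℤ.≟ 0ℤ)

module _ {n} (M : Matrix n) (orthogonal : Orthogonal M) where

  K₂⊗-rowSum : ∀ u → rowSum (K₂ ⊗ M) u ≡ 0ℤ
  K₂⊗-rowSum u = trans (rowSum-⊗ K₂ M u) (trans
    (cong (_* rowSum M (remainder {2} n u)) (K₂-rowSum (quotient n u)))
    (*-zeroˡ (rowSum M (remainder {2} n u))))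

  -- If the remainders differ, orthogonality of `M` gives 0. If they agree, the quotients differ and
  -- the value is -2 times `n`.
  K₂⊗-gram : ∀ {u v} → u ≢ v → gram (K₂ ⊗ M) u v ≤ 0ℤ
  K₂⊗-gram {u} {v} u≢v = subst (_≤ 0ℤ) (sym (gram-⊗ K₂ M u v)) product≤0
    where
    product≤0 : gram K₂ (quotient n u) (quotient n v) * gram M (remainder {2} n u) (remainder {2} n v) ≤ 0ℤ
    product≤0 with remainder {2} n u ≟ remainder {2} n v
    ... | no r≢ = ≤-reflexive (trans
      (cong (λ g → gram K₂ (quotient n u) (quotient n v) * g) (orthogonal r≢))
      (*-zeroʳ (gram K₂ (quotient n u) (quotient n v))))
    ... | yes r≡ = ≤-trans (≤-reflexive (begin
      gram K₂ (quotient n u) (quotient n v) * gram M (remainder {2} n u) (remainder {2} n v)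
        ≡⟨ cong₂ _*_ (K₂-gram (quotient-remainder-≢ K₂ M u≢v r≡))
                     (trans (cong (gram M _) (sym r≡)) (gram-diagonal M (remainder {2} n u))) ⟩
      - + 2 * + n
        ≡⟨ neg-distribˡ-* (+ 2) (+ n) ⟨
      - (+ 2 * + n)
        ≡⟨ cong -_ (sym (pos-* 2 n)) ⟩
      - + (2 ℕ.* n) ∎)) neg-≤0
      where
      neg-≤0 : - + (2 ℕ.* n) ≤ 0ℤ
      neg-≤0 = neg-mono-≤ (+≤+ z≤n)

-- Books in colourings given by sign matrices.

module SignColouring {N} (M : Matrix N) (isM : IsRedDiagonal M)
  (rowSum≡0 : ∀ u → rowSum M u ≡ 0ℤ) (gram≤0 : ∀ {u v} → u ≢ v → gram M u v ≤ 0ℤ) where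
  open IsRedDiagonal isM

  colouring : Colouring N
  colouring = record { colour = M ; colour-sym = symmetric }

  agree? : ∀ c u v → Decidable (λ w → M u w ≡ c × M v w ≡ c)
  agree? c u v w = (M u w ≟ᶜ c) ×-dec (M v w ≟ᶜ c)

  -- Four times the indicator of a = b = c is (1 + σc σa)(1 + σc σb). Summed over the columns, the
  -- linear terms vanish with the row sums, leaving `N` plus a nonpositive inner product.
  4*count-agree : ∀ c {u v} → u ≢ v → 4 ℕ.* count (agree? c u v) ℕ.≤ N
  4*count-agree c {u} {v} u≢v = drop‿+≤+ (subst (_≤ + N) (sym total) (subst (λ s → + N + gram M u v ≤ s) (+-identityʳ (+ N)) (+-monoʳ-≤ (+ N) (gram≤0 u≢v))))
    where
    indicator : ∀ a b c → + 4 * ⟦ does ((a ≟ᶜ c) ×-dec (b ≟ᶜ c)) ⟧ ≡ 1ℤ + σ a * σ b + σ c * (σ a + σ b)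
    indicator red  red  red  = refl
    indicator red  red  blue = refl
    indicator red  blue red  = refl
    indicator red  blue blue = refl
    indicator blue red  red  = refl
    indicator blue red  blue = refl
    indicator blue blue red  = refl
    indicator blue blue blue = refl
    total : + (4 ℕ.* count (agree? c u v)) ≡ + N + gram M u v
    total = begin
      + (4 ℕ.* count (agree? c u v))
        ≡⟨ pos-* 4 (count (agree? c u v)) ⟩
      + 4 * + count (agree? c u v)
        ≡⟨ cong (+ 4 *_) (sum-indicator (agree? c u v)) ⟨
      + 4 * (sum λ w → ⟦ does (agree? c u v w) ⟧)
        ≡⟨ *-distribˡ-sum (+ 4) (λ w → ⟦ does (agree? c u v w) ⟧) ⟩
      (sum λ w → + 4 * ⟦ does (agree? c u v w) ⟧)
        ≡⟨ sum-cong-≗ (λ w → indicator (M u w) (M v w) c) ⟩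
      (sum λ w → 1ℤ + σ (M u w) * σ (M v w) + σ c * (σ (M u w) + σ (M v w)))
        ≡⟨ ∑-distrib-+ (λ w → 1ℤ + σ (M u w) * σ (M v w)) (λ w → σ c * (σ (M u w) + σ (M v w))) ⟩
      (sum λ w → 1ℤ + σ (M u w) * σ (M v w)) + (sum λ w → σ c * (σ (M u w) + σ (M v w)))
        ≡⟨ cong₂ _+_ (∑-distrib-+ (λ _ → 1ℤ) (λ w → σ (M u w) * σ (M v w)))
                     (sym (*-distribˡ-sum (σ c) (λ w → σ (M u w) + σ (M v w)))) ⟩
      sum {N} (λ _ → 1ℤ) + gram M u v + σ c * (sum λ w → σ (M u w) + σ (M v w))
        ≡⟨ cong₂ (λ s t → s + gram M u v + σ c * t) (trans (sum-const N 1ℤ) (*-identityʳ (+ N)))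
             (trans (∑-distrib-+ (λ w → σ (M u w)) (λ w → σ (M v w))) (cong₂ _+_ (rowSum≡0 u) (rowSum≡0 v))) ⟩
      + N + gram M u v + σ c * 0ℤ
        ≡⟨ trans (cong (λ s → + N + gram M u v + s) (*-zeroʳ (σ c))) (+-identityʳ _) ⟩
      + N + gram M u v ∎

  blue-book-bound : ∀ {m} → Contains (colourGraph colouring blue) (book m) → 4 ℕ.* m ℕ.≤ N
  blue-book-bound {m} (f , f-inj , f-adj) = ℕ.≤-trans
    (ℕ.*-monoʳ-≤ 4 (injection⇒≤count (agree? blue u v) (f ∘ inj₂) (λ eq → inj₂-injective (f-inj eq))
      (λ i → proj₂ (f-adj (inj₁ zero) (inj₂ i) tt) , proj₂ (f-adj (inj₁ (suc zero)) (inj₂ i) tt))))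
    (4*count-agree blue (λ eq → contradiction (f-inj eq) λ ()))
    where
    u v : Fin N
    u = f (inj₁ zero)
    v = f (inj₁ (suc zero))
    inj₂-injective : ∀ {A B : Set} {x y : B} → _≡_ {A = A ⊎ B} (inj₂ x) (inj₂ y) → x ≡ y
    inj₂-injective refl = refl

  -- Because the diagonal and the spine edge are red, both spine vertices are also columns where the
  -- two rows are red; they add 2 to the number of pages.
  red-book-bound : ∀ {m} → Contains (colourGraph colouring red) (book m) → 4 ℕ.* (2 ℕ.+ m) ℕ.≤ N
  red-book-bound {m} (f , f-inj , f-adj) = ℕ.≤-trans
    -- `splitAt 2` lists the two spine vertices first and then the `m` pages.
    (ℕ.*-monoʳ-≤ 4 (injection⇒≤count (agree? red u v) (f ∘ splitAt 2)
      (λ {i} {j} eq → splitAt-injective i j (f-inj eq)) (λ i → agree (splitAt 2 i))))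
    (4*count-agree red (λ eq → contradiction (f-inj eq) λ ()))
    where
    u v : Fin N
    u = f (inj₁ zero)
    v = f (inj₁ (suc zero))
    uv : M u v ≡ red
    uv = proj₂ (f-adj (inj₁ zero) (inj₁ (suc zero)) λ ())
    agree : ∀ x → M u (f x) ≡ red × M v (f x) ≡ red
    agree (inj₁ zero)       = diagonal u , trans (symmetric v u) uv
    agree (inj₁ (suc zero)) = uv , diagonal v
    agree (inj₂ i) = proj₂ (f-adj (inj₁ zero) (inj₂ i) tt) , proj₂ (f-adj (inj₁ (suc zero)) (inj₂ i) tt)
    splitAt-injective : ∀ i j → splitAt 2 i ≡ splitAt 2 j → i ≡ j
    splitAt-injective i j eq = trans (sym (join-splitAt 2 m i)) (trans (cong (joinᶠ 2 m) eq) (join-splitAt 2 m j))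

-- Restriction to fewer vertices and the value of the Ramsey number.

restrict : ∀ {M N} → M ℕ.≤ N → Colouring N → Colouring M
restrict M≤N χ = record
  { colour     = λ u v → colour χ (inject≤ u M≤N) (inject≤ v M≤N)
  ; colour-sym = λ u v → colour-sym χ (inject≤ u M≤N) (inject≤ v M≤N)
  }

Contains-restrict : ∀ {M N} (M≤N : M ℕ.≤ N) (χ : Colouring N) {c G} →
  Contains (colourGraph (restrict M≤N χ) c) G → Contains (colourGraph χ c) G
Contains-restrict M≤N χ (f , f-inj , f-adj) =
  (λ x → inject≤ (f x) M≤N) ,
  (λ eq → f-inj (inject≤-injective M≤N M≤N _ _ eq)) ,
  λ x y xy → (λ eq → proj₁ (f-adj x y xy) (inject≤-injective M≤N M≤N _ _ eq)) , proj₂ (f-adj x y xy)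

-- Reduces minimality to one order: a colouring without either book on 4(k + 1) vertices rules out
-- all smaller orders as well.
Arrows-mono : ∀ {M N G G′} → M ℕ.≤ N → Arrows M G G′ → Arrows N G G′
Arrows-mono {G = G} {G′} M≤N arr χ with arr (restrict M≤N χ)
... | inj₁ copy = inj₁ (Contains-restrict M≤N χ {G = G} copy)
... | inj₂ copy = inj₂ (Contains-restrict M≤N χ {G = G′} copy)

¬arrows : ∀ ℓ k → suc k ≡ 2 ℕ.* 4 ℕ.^ ℓ → ¬ Arrows (4 ℕ.* suc k) (book k) (book (suc (suc k)))
¬arrows ℓ k k+1≡2*4^ℓ arr = [ excess ∘ red-book-bound {k} , excess ∘ blue-book-bound {suc (suc k)} ]′
  (subst (λ N → Arrows N (book k) (book (suc (suc k)))) size arr colouring)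
  where
  open SignColouring (K₂ ⊗ H (suc ℓ)) (⊗-isRedDiagonal K₂ (H (suc ℓ)) K₂-isRedDiagonal (H-isRedDiagonal (suc ℓ)))
    (K₂⊗-rowSum (H (suc ℓ)) (H-orthogonal (suc ℓ))) (K₂⊗-gram (H (suc ℓ)) (H-orthogonal (suc ℓ)))
  rearrange : ∀ x → 4 ℕ.* (2 ℕ.* x) ≡ 2 ℕ.* (4 ℕ.* x)
  rearrange = ℕ-solver.solve-∀
  size : 4 ℕ.* suc k ≡ 2 ℕ.* 4 ℕ.^ suc ℓ
  size = trans (cong (4 ℕ.*_) k+1≡2*4^ℓ) (rearrange (4 ℕ.^ ℓ))
  -- Both colours lead to 4(k + 2) ≤ 4(k + 1): red from `k` pages and two spine vertices, blue from
  -- k + 2 pages.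
  excess : 4 ℕ.* (2 ℕ.+ k) ℕ.≤ 2 ℕ.* 4 ℕ.^ suc ℓ → ⊥
  excess 4[k+2]≤ = ℕ.<-irrefl refl (ℕ.*-cancelˡ-≤ {suc (suc k)} {suc k} 4 (subst (4 ℕ.* (2 ℕ.+ k) ℕ.≤_) (sym size) 4[k+2]≤))

-- Initially 2 squared is -1 modulo 5, and each step multiplies the square by 16, which is 1 modulo
-- 5.
[2*4^ℓ]²+1 : ∀ ℓ → ∃ λ m → + (2 ℕ.* 4 ℕ.^ ℓ) * + (2 ℕ.* 4 ℕ.^ ℓ) + 1ℤ ≡ + 5 * m
[2*4^ℓ]²+1 zero = 1ℤ , refl
[2*4^ℓ]²+1 (suc ℓ) with m , eq ← [2*4^ℓ]²+1 ℓ = + 16 * m - + 3 , (begin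
  + (2 ℕ.* (4 ℕ.* x)) * + (2 ℕ.* (4 ℕ.* x)) + 1ℤ ≡⟨ cong (λ y → y * y + 1ℤ) (trans (cong +_ (rearrange x)) (pos-* 4 (2 ℕ.* x))) ⟩
  + 4 * y * (+ 4 * y) + 1ℤ                       ≡⟨ expand y ⟩
  + 16 * (y * y + 1ℤ) - + 15                     ≡⟨ cong (λ s → + 16 * s - + 15) eq ⟩
  + 16 * (+ 5 * m) - + 15                        ≡⟨ collect m ⟩
  + 5 * (+ 16 * m - + 3)                         ∎)
  where
  x : ℕ
  x = 4 ℕ.^ ℓ
  y : ℤ
  y = + (2 ℕ.* x)
  rearrange : ∀ x → 2 ℕ.* (4 ℕ.* x) ≡ 4 ℕ.* (2 ℕ.* x)
  rearrange = ℕ-solver.solve-∀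
  expand : ∀ y → + 4 * y * (+ 4 * y) + 1ℤ ≡ + 16 * (y * y + 1ℤ) - + 15
  expand = solve-∀
  collect : ∀ m → + 16 * (+ 5 * m) - + 15 ≡ + 5 * (+ 16 * m - + 3)
  collect = solve-∀

ramsey-book : ∀ ℓ k → suc k ≡ 2 ℕ.* 4 ℕ.^ ℓ →
  IsRamseyNumber (book k) (book (suc (suc k))) (suc (4 ℕ.* suc k))
ramsey-book ℓ k k+1≡2*4^ℓ with m , eq ← [2*4^ℓ]²+1 ℓ =
  arrows k m (subst (λ x → + x * + x + 1ℤ ≡ + 5 * m) (sym k+1≡2*4^ℓ) eq) ,
  λ M arr → ℕ.≰⇒> λ M≤4k → ¬arrows ℓ k k+1≡2*4^ℓ (Arrows-mono {G = book k} {book (suc (suc k))} M≤4k arr)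

corollary1p2 : (ℓ n : ℕ) → 1 ℕ.≤ ℓ → n ≡ 2 ℕ.^ (2 ℕ.* ℓ ℕ.∸ 1) ℕ.+ 1 →
    IsRamseyNumber (book (n ℕ.∸ 2)) (book n) (4 ℕ.* n ℕ.∸ 3)
-- With the exponent parameter written as `suc ℓ`, the power of two is 2 · 4^ℓ = k + 1, so `n` is k
-- + 2 and `n ∸ 2` computes to `k`.
corollary1p2 (suc ℓ) n _ n≡ = subst (λ n → IsRamseyNumber (book (n ℕ.∸ 2)) (book n) (4 ℕ.* n ℕ.∸ 3)) (sym n≡k+2)
  (subst (IsRamseyNumber (book k) (book (suc (suc k)))) (order k) (ramsey-book ℓ k k+1≡))
  where
  k : ℕ
  k = ℕ.pred (2 ℕ.* 4 ℕ.^ ℓ)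
  k+1≡ : suc k ≡ 2 ℕ.* 4 ℕ.^ ℓ
  k+1≡ = ℕ.suc-pred (2 ℕ.* 4 ℕ.^ ℓ) {{ℕ.m*n≢0 2 (4 ℕ.^ ℓ) {{_}} {{ℕ.m^n≢0 4 ℓ}}}}
  exponent : ∀ ℓ → 2 ℕ.* suc ℓ ℕ.∸ 1 ≡ suc (2 ℕ.* ℓ)
  exponent ℓ = ℕ.+-suc ℓ (ℓ ℕ.+ 0)
  order : ∀ k → suc (4 ℕ.* suc k) ≡ 4 ℕ.* suc (suc k) ℕ.∸ 3
  order k = sym (cong (ℕ._∸ 3) (rearrange k))
    where
    rearrange : ∀ k → 4 ℕ.* suc (suc k) ≡ 3 ℕ.+ suc (4 ℕ.* suc k)
    rearrange = ℕ-solver.solve-∀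
  n≡k+2 : n ≡ suc (suc k)
  n≡k+2 = begin
    n                                        ≡⟨ n≡ ⟩
    2 ℕ.^ (2 ℕ.* suc ℓ ℕ.∸ 1) ℕ.+ 1          ≡⟨ cong (λ e → 2 ℕ.^ e ℕ.+ 1) (exponent ℓ) ⟩
    2 ℕ.* 2 ℕ.^ (2 ℕ.* ℓ) ℕ.+ 1              ≡⟨ cong (λ x → 2 ℕ.* x ℕ.+ 1) (sym (ℕ.^-*-assoc 2 2 ℓ)) ⟩
    2 ℕ.* 4 ℕ.^ ℓ ℕ.+ 1                      ≡⟨ cong (ℕ._+ 1) (sym k+1≡) ⟩
    suc k ℕ.+ 1                              ≡⟨ ℕ.+-comm (suc k) 1 ⟩
    suc (suc k)                              ∎
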